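{- Every Bernstein set $B\subseteq\mathbb R^2$ is a $2$-I-covering.
   Context: A set $B\subseteq\mathbb R^2$ is a Bernstein set if for every uncountable Borel $Z\subseteq\mathbb R^2$ both $Z\cap B$ and $Z\setminus B$ are nonempty. A set $A\subseteq\mathbb R^2$ is a $2$-I-covering if for every $C\subseteq\mathbb R^2$ with $|C|=2$ there is an isometry $\phi$ of the Euclidean plane with $\phi[C]\subseteq A$. -}

module Defs where

open import Data.Fin.Base using (Fin)
open import Data.Nat.Base as ℕ using (ℕ)
import Data.Nat.Properties as ℕ
open import Data.Product.Base using (Σ; ∃; ∃-syntax; _×_; _,_; proj₁; proj₂)
open import Data.Product.Relation.Binary.Pointwise.NonDependent using (×-setoid)
open import Data.Rational.Base as ℚ using (ℚ; 0ℚ; 1ℚ; ½)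
import Data.Rational.Properties as ℚ
open import Function.Bundles using (Bijection; Injection)
open import Function.Definitions using (Surjective)
open import Level using (Level; 0ℓ; suc; _⊔_)
open import Relation.Binary.Bundles using (Setoid)
open import Relation.Binary.Definitions using (_Respects_)
import Relation.Binary.Construct.On as On
open import Relation.Binary.PropositionalEquality
  using (_≡_; refl; sym; trans; cong; subst; setoid)
open import Relation.Nullary.Decidable.Core using (dec⇒maybe)
open import Relation.Nullary.Negation.Core using (¬_)
open import Relation.Unary using (Pred; _∈_; _⊆_; _≐_; _∩_; _∖_; ∁; ⋃; Satisfiable)
open import Tactic.RingSolver using (solve-∀)
open import Tactic.RingSolver.Core.AlmostCommutativeRing
  using (AlmostCommutativeRing; fromCommutativeRing)

private
  variable
    ℓ : Level

Eventually : Pred ℕ ℓ → Set ℓ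
Eventually P = ∃[ N ] ∀ n → N ℕ.≤ n → P n

IsCauchy : (ℕ → ℚ) → Set
IsCauchy x = ∀ ε → 0ℚ ℚ.< ε →
  ∃[ N ] ∀ m n → N ℕ.≤ m → N ℕ.≤ n → ℚ.∣ x m ℚ.- x n ∣ ℚ.< ε

-- Equality of reals is _≈_ below; the modulus in a Cauchy proof is irrelevant
-- to it.

record ℝ : Set where
  constructor mkℝ
  field
    seq    : ℕ → ℚ
    cauchy : IsCauchy seq

open ℝ public

infix 4 _≈_ _<_ _≤_

_≈_ : ℝ → ℝ → Set
x ≈ y = ∀ ε → 0ℚ ℚ.< ε → Eventually λ n → ℚ.∣ seq x n ℚ.- seq y n ∣ ℚ.< ε

_<_ : ℝ → ℝ → Set
x < y = ∃[ ε ] 0ℚ ℚ.< ε × Eventually λ n → seq x n ℚ.+ ε ℚ.< seq y n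

_≤_ : ℝ → ℝ → Set
x ≤ y = ¬ (y < x)

private
  ℚ-ring : AlmostCommutativeRing 0ℓ 0ℓ
  ℚ-ring = fromCommutativeRing ℚ.+-*-commutativeRing (λ q → dec⇒maybe (0ℚ ℚ.≟ q))

  0<half : ∀ {ε} → 0ℚ ℚ.< ε → 0ℚ ℚ.< ε ℚ.* ½
  0<half 0<ε = ℚ.*-monoˡ-<-pos ½ 0<ε

  half+half : ∀ ε → ε ℚ.* ½ ℚ.+ ε ℚ.* ½ ≡ ε
  half+half ε = trans (sym (ℚ.*-distribˡ-+ ε ½ ½)) (ℚ.*-identityʳ ε)

  ∣p-q∣≡∣q-p∣ : ∀ p q → ℚ.∣ p ℚ.- q ∣ ≡ ℚ.∣ q ℚ.- p ∣
  ∣p-q∣≡∣q-p∣ p q = trans (sym (ℚ.∣-p∣≡∣p∣ (p ℚ.- q))) (cong ℚ.∣_∣ (eq p q))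
    where
    eq : ∀ p q → ℚ.- (p ℚ.- q) ≡ q ℚ.- p
    eq = solve-∀ ℚ-ring

  halves : ∀ {ε p q r} → r ≡ p ℚ.+ q →
           ℚ.∣ p ∣ ℚ.< ε ℚ.* ½ → ℚ.∣ q ∣ ℚ.< ε ℚ.* ½ → ℚ.∣ r ∣ ℚ.< ε
  halves {ε} {p} {q} {r} r≡p+q p< q< = begin-strict
    ℚ.∣ r ∣             ≡⟨ cong ℚ.∣_∣ r≡p+q ⟩
    ℚ.∣ p ℚ.+ q ∣       ≤⟨ ℚ.∣p+q∣≤∣p∣+∣q∣ p q ⟩
    ℚ.∣ p ∣ ℚ.+ ℚ.∣ q ∣ <⟨ ℚ.+-mono-< p< q< ⟩
    ε ℚ.* ½ ℚ.+ ε ℚ.* ½ ≡⟨ half+half ε ⟩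
    ε                   ∎
    where open ℚ.≤-Reasoning

≈-refl : ∀ {x} → x ≈ x
≈-refl {x} ε 0<ε = 0 , λ n _ →
  subst (ℚ._< ε) (sym (cong ℚ.∣_∣ (ℚ.+-inverseʳ (seq x n)))) 0<ε

≈-sym : ∀ {x y} → x ≈ y → y ≈ x
≈-sym {x} {y} x≈y ε 0<ε with x≈y ε 0<ε
... | N , h = N , λ n N≤n →
  subst (ℚ._< ε) (∣p-q∣≡∣q-p∣ (seq x n) (seq y n)) (h n N≤n)

≈-trans : ∀ {x y z} → x ≈ y → y ≈ z → x ≈ z
≈-trans {x} {y} {z} x≈y y≈z ε 0<ε
  with x≈y (ε ℚ.* ½) (0<half 0<ε) | y≈z (ε ℚ.* ½) (0<half 0<ε)
... | M , f | N , g = M ℕ.⊔ N , λ n M⊔N≤n →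
  halves (eq (seq x n) (seq y n) (seq z n))
    (f n (ℕ.≤-trans (ℕ.m≤m⊔n M N) M⊔N≤n))
    (g n (ℕ.≤-trans (ℕ.m≤n⊔m M N) M⊔N≤n))
  where
  eq : ∀ p q r → p ℚ.- r ≡ (p ℚ.- q) ℚ.+ (q ℚ.- r)
  eq = solve-∀ ℚ-ring

ℝ-setoid : Setoid 0ℓ 0ℓ
ℝ-setoid = record
  { Carrier       = ℝ
  ; _≈_           = _≈_
  ; isEquivalence = record
    { refl  = λ {x} → ≈-refl {x}
    ; sym   = λ {x} {y} → ≈-sym {x} {y}
    ; trans = λ {x} {y} {z} → ≈-trans {x} {y} {z}
    }
  }

0ℝ : ℝ
0ℝ = mkℝ (λ _ → 0ℚ) λ ε 0<ε → 0 , λ _ _ _ _ → 0<ε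

infixl 6 _+_ _-_
infixl 7 _*_
infix  8 -_

_+_ : ℝ → ℝ → ℝ
mkℝ x cx + mkℝ y cy = mkℝ (λ n → x n ℚ.+ y n) c
  where
  eq : ∀ p q r s → (p ℚ.+ q) ℚ.- (r ℚ.+ s) ≡ (p ℚ.- r) ℚ.+ (q ℚ.- s)
  eq = solve-∀ ℚ-ring

  c : IsCauchy (λ n → x n ℚ.+ y n)
  c ε 0<ε with cx (ε ℚ.* ½) (0<half 0<ε) | cy (ε ℚ.* ½) (0<half 0<ε)
  ... | M , f | N , g = M ℕ.⊔ N , λ m n ≤m ≤n →
    halves (eq (x m) (y m) (x n) (y n))
      (f m n (ℕ.≤-trans (ℕ.m≤m⊔n M N) ≤m) (ℕ.≤-trans (ℕ.m≤m⊔n M N) ≤n))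
      (g m n (ℕ.≤-trans (ℕ.m≤n⊔m M N) ≤m) (ℕ.≤-trans (ℕ.m≤n⊔m M N) ≤n))

-_ : ℝ → ℝ
- mkℝ x cx = mkℝ (λ n → ℚ.- x n) λ ε 0<ε → let N , f = cx ε 0<ε in
  N , λ m n ≤m ≤n → subst (ℚ._< ε)
    (trans (∣p-q∣≡∣q-p∣ (x m) (x n)) (cong ℚ.∣_∣ (eq (x m) (x n)))) (f m n ≤m ≤n)
  where
  eq : ∀ p q → q ℚ.- p ≡ (ℚ.- p) ℚ.- (ℚ.- q)
  eq = solve-∀ ℚ-ring

_-_ : ℝ → ℝ → ℝ
x - y = x + (- y)

private
  cauchy⇒bounded : ∀ {x} → IsCauchy x →
    ∃[ K ] 0ℚ ℚ.< K × Eventually λ n → ℚ.∣ x n ∣ ℚ.< K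
  cauchy⇒bounded {x} cx with cx 1ℚ (ℚ.positive⁻¹ 1ℚ)
  ... | N , f = K , ℚ.≤-<-trans (ℚ.0≤∣p∣ (x N)) (bound N ℕ.≤-refl) , N , bound
    where
    K = 1ℚ ℚ.+ ℚ.∣ x N ∣

    eq : ∀ p q → p ≡ (p ℚ.- q) ℚ.+ q
    eq = solve-∀ ℚ-ring

    bound : ∀ n → N ℕ.≤ n → ℚ.∣ x n ∣ ℚ.< K
    bound n N≤n = begin-strict
      ℚ.∣ x n ∣                         ≡⟨ cong ℚ.∣_∣ (eq (x n) (x N)) ⟩
      ℚ.∣ (x n ℚ.- x N) ℚ.+ x N ∣       ≤⟨ ℚ.∣p+q∣≤∣p∣+∣q∣ (x n ℚ.- x N) (x N) ⟩
      ℚ.∣ x n ℚ.- x N ∣ ℚ.+ ℚ.∣ x N ∣   <⟨ ℚ.+-monoˡ-< ℚ.∣ x N ∣ (f n N N≤n ℕ.≤-refl) ⟩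
      K                                 ∎
      where open ℚ.≤-Reasoning

  scale : ∀ {K} → 0ℚ ℚ.< K → ∀ ε → 0ℚ ℚ.< ε →
    ∃[ δ ] 0ℚ ℚ.< δ × K ℚ.* δ ≡ ε
  scale {K} 0<K ε 0<ε = ℚ.1/ K ℚ.* ε , 0<δ , eq
    where
    instance
      K-pos : ℚ.Positive K
      K-pos = ℚ.positive 0<K
      K-nonZero : ℚ.NonZero K
      K-nonZero = ℚ.pos⇒nonZero K
      1/K-pos : ℚ.Positive (ℚ.1/ K)
      1/K-pos = ℚ.1/pos⇒pos K

    0<δ : 0ℚ ℚ.< ℚ.1/ K ℚ.* ε
    0<δ = subst (ℚ._< ℚ.1/ K ℚ.* ε) (ℚ.*-zeroʳ (ℚ.1/ K))
      (ℚ.*-monoʳ-<-pos (ℚ.1/ K) 0<ε)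

    eq : K ℚ.* (ℚ.1/ K ℚ.* ε) ≡ ε
    eq = trans (sym (ℚ.*-assoc K (ℚ.1/ K) ε))
      (trans (cong (ℚ._* ε) (ℚ.*-inverseʳ K)) (ℚ.*-identityˡ ε))

  bounded*small : ∀ {K δ ε} → 0ℚ ℚ.< K → K ℚ.* δ ≡ ε → ∀ p q →
    ℚ.∣ p ∣ ℚ.< K → ℚ.∣ q ∣ ℚ.< δ → ℚ.∣ p ℚ.* q ∣ ℚ.< ε
  bounded*small {K} {δ} {ε} 0<K Kδ≡ε p q p<K q<δ = begin-strict
    ℚ.∣ p ℚ.* q ∣       ≡⟨ ℚ.∣p*q∣≡∣p∣*∣q∣ p q ⟩
    ℚ.∣ p ∣ ℚ.* ℚ.∣ q ∣ ≤⟨ ℚ.*-monoʳ-≤-nonNeg ℚ.∣ q ∣ {{ℚ.nonNegative (ℚ.0≤∣p∣ q)}} (ℚ.<⇒≤ p<K) ⟩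
    K ℚ.* ℚ.∣ q ∣       <⟨ ℚ.*-monoʳ-<-pos K {{ℚ.positive 0<K}} q<δ ⟩
    K ℚ.* δ             ≡⟨ Kδ≡ε ⟩
    ε                   ∎
    where open ℚ.≤-Reasoning

_*_ : ℝ → ℝ → ℝ
mkℝ x cx * mkℝ y cy = mkℝ (λ n → x n ℚ.* y n) c
  where
  eq : ∀ p q r s → p ℚ.* q ℚ.- r ℚ.* s ≡ p ℚ.* (q ℚ.- s) ℚ.+ s ℚ.* (p ℚ.- r)
  eq = solve-∀ ℚ-ring

  c : IsCauchy (λ n → x n ℚ.* y n)
  c ε 0<ε = (A ℕ.⊔ B) ℕ.⊔ (M ℕ.⊔ N) , λ m n ≤m ≤n →
    halves (eq (x m) (y m) (x n) (y n))
      (bounded*small 0<K Kδ≡ (x m) (y m ℚ.- y n) (x<K m (toA ≤m)) (g m n (toN ≤m) (toN ≤n)))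
      (bounded*small 0<L Lη≡ (y n) (x m ℚ.- x n) (y<L n (toB ≤n)) (f m n (toM ≤m) (toM ≤n)))
    where
    bx = cauchy⇒bounded cx
    by = cauchy⇒bounded cy
    K   = proj₁ bx
    0<K = proj₁ (proj₂ bx)
    A   = proj₁ (proj₂ (proj₂ bx))
    x<K = proj₂ (proj₂ (proj₂ bx))
    L   = proj₁ by
    0<L = proj₁ (proj₂ by)
    B   = proj₁ (proj₂ (proj₂ by))
    y<L = proj₂ (proj₂ (proj₂ by))
    sδ = scale 0<K (ε ℚ.* ½) (0<half 0<ε)
    sη = scale 0<L (ε ℚ.* ½) (0<half 0<ε)
    δ   = proj₁ sδ
    0<δ = proj₁ (proj₂ sδ)
    Kδ≡ = proj₂ (proj₂ sδ)
    η   = proj₁ sη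
    0<η = proj₁ (proj₂ sη)
    Lη≡ = proj₂ (proj₂ sη)
    M = proj₁ (cx η 0<η)
    f = proj₂ (cx η 0<η)
    N = proj₁ (cy δ 0<δ)
    g = proj₂ (cy δ 0<δ)

    AB≤ = ℕ.m≤m⊔n (A ℕ.⊔ B) (M ℕ.⊔ N)
    MN≤ = ℕ.m≤n⊔m (A ℕ.⊔ B) (M ℕ.⊔ N)

    toA : ∀ {n} → (A ℕ.⊔ B) ℕ.⊔ (M ℕ.⊔ N) ℕ.≤ n → A ℕ.≤ n
    toA h = ℕ.≤-trans (ℕ.m≤m⊔n A B) (ℕ.≤-trans AB≤ h)

    toB : ∀ {n} → (A ℕ.⊔ B) ℕ.⊔ (M ℕ.⊔ N) ℕ.≤ n → B ℕ.≤ n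
    toB h = ℕ.≤-trans (ℕ.m≤n⊔m A B) (ℕ.≤-trans AB≤ h)

    toM : ∀ {n} → (A ℕ.⊔ B) ℕ.⊔ (M ℕ.⊔ N) ℕ.≤ n → M ℕ.≤ n
    toM h = ℕ.≤-trans (ℕ.m≤m⊔n M N) (ℕ.≤-trans MN≤ h)

    toN : ∀ {n} → (A ℕ.⊔ B) ℕ.⊔ (M ℕ.⊔ N) ℕ.≤ n → N ℕ.≤ n
    toN h = ℕ.≤-trans (ℕ.m≤n⊔m M N) (ℕ.≤-trans MN≤ h)

ℝ²-setoid : Setoid 0ℓ 0ℓ
ℝ²-setoid = ×-setoid ℝ-setoid ℝ-setoid

ℝ² : Set
ℝ² = Setoid.Carrier ℝ²-setoid

infix 4 _≈₂_

_≈₂_ : ℝ² → ℝ² → Set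
_≈₂_ = Setoid._≈_ ℝ²-setoid

-- The graph of the Euclidean distance: d = √((x₁ - x₂)² + (y₁ - y₂)²).
-- The root is named by its defining property instead of by a function
-- √ on Cauchy sequences.

IsDistance : ℝ² → ℝ² → ℝ → Set
IsDistance (x₁ , y₁) (x₂ , y₂) d =
  0ℝ ≤ d × d * d ≈ (x₁ - x₂) * (x₁ - x₂) + (y₁ - y₂) * (y₁ - y₂)

Ball : ℝ² → ℝ → Pred ℝ² 0ℓ
Ball p r q = ∃[ d ] IsDistance p q d × d < r

record IsIsometry (φ : ℝ² → ℝ²) : Set where
  field
    preserves-distance : ∀ p q d → IsDistance p q d → IsDistance (φ p) (φ q) d
    surjective         : Surjective _≈₂_ _≈₂_ φ

-- A predicate is a subset of ℝ² only if it does not distinguish Cauchy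
-- sequences with the same limit.

IsSubset : Pred ℝ² ℓ → Set ℓ
IsSubset A = A Respects _≈₂_

subset : Pred ℝ² ℓ → Setoid ℓ 0ℓ
subset A = On.setoid {B = Σ ℝ² A} ℝ²-setoid proj₁

_has-cardinality_ : Pred ℝ² ℓ → ℕ → Set ℓ
A has-cardinality n = Bijection (setoid (Fin n)) (subset A)

Countable : Pred ℝ² ℓ → Set ℓ
Countable A = Injection (subset A) (setoid ℕ)

Uncountable : Pred ℝ² ℓ → Set ℓ
Uncountable A = ¬ Countable A

image : (ℝ² → ℝ²) → Pred ℝ² ℓ → Pred ℝ² ℓ
image φ C y = ∃[ x ] x ∈ C × φ x ≈₂ y

IsOpen : Pred ℝ² 0ℓ → Set
IsOpen U = ∀ {p} → p ∈ U → ∃[ r ] 0ℝ < r × Ball p r ⊆ U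

-- The σ-algebra generated by the open sets. The last constructor says that
-- being Borel depends only on which points belong to the set.

data Borel : Pred ℝ² 0ℓ → Set₁ where
  isOpen     : ∀ {U} → IsOpen U → Borel U
  complement : ∀ {A} → Borel A → Borel (∁ A)
  union      : (A : ℕ → Pred ℝ² 0ℓ) → (∀ n → Borel (A n)) → Borel (⋃ ℕ A)
  resp-≐     : ∀ {A A′} → A ≐ A′ → Borel A → Borel A′

IsBernstein : Pred ℝ² ℓ → Set (suc 0ℓ ⊔ ℓ)
IsBernstein B = ∀ Z → Borel Z → Uncountable Z →
  Satisfiable (Z ∩ B) × Satisfiable (Z ∖ B)

_-I-covering : ℕ → Pred ℝ² ℓ → Set (suc ℓ)
_-I-covering {ℓ} n A = (C : Pred ℝ² ℓ) → IsSubset C → C has-cardinality n →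
  ∃[ φ ] IsIsometry φ × image φ C ⊆ A

{-# OPTIONS --safe #-}
module Submission where

-- Let p ≠ q be the points of C and put c = ∥ q - p ∥². Every circle is an
-- uncountable Borel set, so B contains a point b, and then a point b′ on the
-- circle about b with squared radius c. Reading points as complex numbers,
-- z ↦ b + w (z - p) with w = (b′ - b) / (q - p) is an isometry, because
-- |w| = 1, and it carries p to b and q to b′. Circles are uncountable because
-- 2^ℕ embeds into ℝ by base-four expansions and ℝ into the circle by
-- t ↦ (1 + it)² / (1 + t²).
--
-- x ≈ y unfolds to nullity of the sequence of differences, so an equation
-- between reals follows from others by writing its difference as a linear
-- combination of theirs: an identity in ℚ, combined by _+₀_ and _*₀_.

open import Axiom.ExcludedMiddle using (ExcludedMiddle)
open import Data.Bool.Base using (Bool; true; false)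
open import Data.Empty using (⊥)
import Data.Fin.Base as Fin
import Data.Integer.Base as ℤ
open import Data.Nat.Base as ℕ using (ℕ; zero; suc)
open import Data.Nat.Coprimality using (1-coprimeTo)
import Data.Nat.Properties as ℕ
open import Data.Product.Base using (∃-syntax; _×_; _,_; proj₁; proj₂)
open import Data.Rational.Base as ℚ using (ℚ; 0ℚ; 1ℚ; ½)
import Data.Rational.Properties as ℚ
import Data.Rational.Unnormalised.Base as ℚᵘ
import Data.Rational.Unnormalised.Properties as ℚᵘ
open import Data.Sum.Base using (inj₁; inj₂)
open import Function.Base using (_∘_)
open import Function.Bundles using (Bijection; Injection)
open import Level using (Level; 0ℓ)
open import Relation.Binary.Bundles using (Setoid)
open import Relation.Binary.PropositionalEquality
  using (_≡_; refl; sym; trans; cong; cong₂; subst; subst₂; module ≡-Reasoning)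
open import Relation.Nullary.Decidable
  using (does; yes; no; dec-true; dec-false; dec⇒maybe; decidable-stable)
open import Relation.Nullary.Negation.Core using (¬_; contradiction)
open import Relation.Unary using (Pred; _∩_; _⊆_; ∁)
open import Tactic.RingSolver using (solve-∀)
open import Tactic.RingSolver.Core.AlmostCommutativeRing
  using (AlmostCommutativeRing; fromCommutativeRing)
open import Defs

private
  variable
    ℓ : Level

ℚ-ring : AlmostCommutativeRing 0ℓ 0ℓ
ℚ-ring = fromCommutativeRing ℚ.+-*-commutativeRing (λ q → dec⇒maybe (0ℚ ℚ.≟ q))

-- Rational inequalities

0<p*q : ∀ {p q} → 0ℚ ℚ.< p → 0ℚ ℚ.< q → 0ℚ ℚ.< p ℚ.* q
0<p*q {p} {q} 0<p 0<q =
  ℚ.positive⁻¹ (p ℚ.* q) {{ℚ.pos*pos⇒pos p {{ℚ.positive 0<p}} q {{ℚ.positive 0<q}}}}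

0<ε/2 : ∀ {ε} → 0ℚ ℚ.< ε → 0ℚ ℚ.< ε ℚ.* ½
0<ε/2 0<ε = ℚ.*-monoˡ-<-pos ½ 0<ε

ε/2+ε/2≡ε : ∀ ε → ε ℚ.* ½ ℚ.+ ε ℚ.* ½ ≡ ε
ε/2+ε/2≡ε = solve-∀ ℚ-ring

p≤∣p∣ : ∀ p → p ℚ.≤ ℚ.∣ p ∣
p≤∣p∣ p with ℚ.≤-total 0ℚ p
... | inj₁ 0≤p = ℚ.≤-reflexive (sym (ℚ.0≤p⇒∣p∣≡p 0≤p))
... | inj₂ p≤0 = ℚ.≤-trans p≤0 (ℚ.0≤∣p∣ p)

-p≤∣p∣ : ∀ p → ℚ.- p ℚ.≤ ℚ.∣ p ∣
-p≤∣p∣ p = subst (ℚ.- p ℚ.≤_) (ℚ.∣-p∣≡∣p∣ p) (p≤∣p∣ (ℚ.- p))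

neg-neg : ∀ r → ℚ.- (ℚ.- r) ≡ r
neg-neg = solve-∀ ℚ-ring

∣p∣<r : ∀ {p r} → ℚ.- r ℚ.< p → p ℚ.< r → ℚ.∣ p ∣ ℚ.< r
∣p∣<r {p} {r} -r<p p<r with ℚ.∣p∣≡p∨∣p∣≡-p p
... | inj₁ eq = subst (ℚ._< r) (sym eq) p<r
... | inj₂ eq = subst (ℚ._< r) (sym eq)
  (subst (ℚ.- p ℚ.<_) (neg-neg r) (ℚ.neg-antimono-< -r<p))

-[p-q]≡q-p : ∀ p q → ℚ.- (p ℚ.- q) ≡ q ℚ.- p
-[p-q]≡q-p = solve-∀ ℚ-ring

∣p+q∣<r+s : ∀ {p q r s} → ℚ.∣ p ∣ ℚ.< r → ℚ.∣ q ∣ ℚ.< s → ℚ.∣ p ℚ.+ q ∣ ℚ.< r ℚ.+ s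
∣p+q∣<r+s {p} {q} p<r q<s = ℚ.≤-<-trans (ℚ.∣p+q∣≤∣p∣+∣q∣ p q) (ℚ.+-mono-< p<r q<s)

∣p+q∣<ε : ∀ {ε p q} → ℚ.∣ p ∣ ℚ.< ε ℚ.* ½ → ℚ.∣ q ∣ ℚ.< ε ℚ.* ½ → ℚ.∣ p ℚ.+ q ∣ ℚ.< ε
∣p+q∣<ε {ε} {p} {q} p< q< = subst (ℚ.∣ p ℚ.+ q ∣ ℚ.<_) (ε/2+ε/2≡ε ε) (∣p+q∣<r+s {p} {q} p< q<)

∣p*q∣<r*s : ∀ {p q r s} → ℚ.∣ p ∣ ℚ.< r → ℚ.∣ q ∣ ℚ.< s → ℚ.∣ p ℚ.* q ∣ ℚ.< r ℚ.* s
∣p*q∣<r*s {p} {q} {r} {s} p<r q<s = begin-strict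
  ℚ.∣ p ℚ.* q ∣       ≡⟨ ℚ.∣p*q∣≡∣p∣*∣q∣ p q ⟩
  ℚ.∣ p ∣ ℚ.* ℚ.∣ q ∣ ≤⟨ ℚ.*-monoʳ-≤-nonNeg ℚ.∣ q ∣ {{ℚ.∣-∣-nonNeg q}} (ℚ.<⇒≤ p<r) ⟩
  r ℚ.* ℚ.∣ q ∣       <⟨ ℚ.*-monoʳ-<-pos r {{ℚ.positive (ℚ.≤-<-trans (ℚ.0≤∣p∣ p) p<r)}} q<s ⟩
  r ℚ.* s             ∎
  where open ℚ.≤-Reasoning

0≤p*p : ∀ p → 0ℚ ℚ.≤ p ℚ.* p
0≤p*p p with ℚ.≤-total 0ℚ p
... | inj₁ 0≤p = ℚ.nonNegative⁻¹ (p ℚ.* p)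
  {{ℚ.nonNeg*nonNeg⇒nonNeg p {{ℚ.nonNegative 0≤p}} p {{ℚ.nonNegative 0≤p}}}}
... | inj₂ p≤0 = ℚ.nonNegative⁻¹ (p ℚ.* p)
  {{ℚ.nonPos*nonPos⇒nonPos p {{ℚ.nonPositive p≤0}} p {{ℚ.nonPositive p≤0}}}}

p≤p+q*q : ∀ p q → p ℚ.≤ p ℚ.+ q ℚ.* q
p≤p+q*q p q = subst (ℚ._≤ p ℚ.+ q ℚ.* q) (ℚ.+-identityʳ p) (ℚ.+-monoʳ-≤ p (0≤p*p q))

∣p∣<r-from-p*p<r*r : ∀ {p r} → 0ℚ ℚ.< r → p ℚ.* p ℚ.< r ℚ.* r → ℚ.∣ p ∣ ℚ.< r
∣p∣<r-from-p*p<r*r {p} {r} 0<r p²<r² with ℚ.∣ p ∣ ℚ.<? r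
... | yes p<r = p<r
... | no  p≮r = contradiction (ℚ.<-≤-trans p²<r² r²≤p²) (ℚ.<-irrefl refl)
  where
  open ℚ.≤-Reasoning
  r≤∣p∣ = ℚ.≮⇒≥ p≮r
  r²≤p² : r ℚ.* r ℚ.≤ p ℚ.* p
  r²≤p² = begin
    r ℚ.* r             ≤⟨ ℚ.*-monoʳ-≤-nonNeg r {{ℚ.nonNegative (ℚ.<⇒≤ 0<r)}} r≤∣p∣ ⟩
    ℚ.∣ p ∣ ℚ.* r       ≤⟨ ℚ.*-monoˡ-≤-nonNeg ℚ.∣ p ∣ {{ℚ.∣-∣-nonNeg p}} r≤∣p∣ ⟩
    ℚ.∣ p ∣ ℚ.* ℚ.∣ p ∣ ≡⟨ ℚ.∣p*q∣≡∣p∣*∣q∣ p p ⟨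
    ℚ.∣ p ℚ.* p ∣       ≡⟨ ℚ.0≤p⇒∣p∣≡p (0≤p*p p) ⟩
    p ℚ.* p             ∎

1/-scaled : ∀ {r} → 0ℚ ℚ.< r → ∀ {ε} → 0ℚ ℚ.< ε → ∃[ δ ] 0ℚ ℚ.< δ × r ℚ.* δ ≡ ε
1/-scaled {r} 0<r {ε} 0<ε = ℚ.1/ r ℚ.* ε , 0<p*q (ℚ.positive⁻¹ (ℚ.1/ r)) 0<ε ,
  trans (sym (ℚ.*-assoc r (ℚ.1/ r) ε))
    (trans (cong (ℚ._* ε) (ℚ.*-inverseʳ r)) (ℚ.*-identityˡ ε))
  where
  instance
    r-pos : ℚ.Positive r
    r-pos = ℚ.positive 0<r
    r-nonZero : ℚ.NonZero r
    r-nonZero = ℚ.pos⇒nonZero r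
    1/r-pos : ℚ.Positive (ℚ.1/ r)
    1/r-pos = ℚ.1/pos⇒pos r

-- Null sequences

both : ∀ {P Q : Pred ℕ 0ℓ} → Eventually P → Eventually Q → Eventually (P ∩ Q)
both (M , f) (N , g) = M ℕ.⊔ N , λ n h →
  f n (ℕ.≤-trans (ℕ.m≤m⊔n M N) h) , g n (ℕ.≤-trans (ℕ.m≤n⊔m M N) h)

eventually-map : ∀ {P Q : Pred ℕ 0ℓ} → (∀ {n} → P n → Q n) → Eventually P → Eventually Q
eventually-map g (N , f) = N , λ n h → g (f n h)

eventually-const : {A : Set} → Eventually (λ _ → A) → A
eventually-const (N , f) = f N ℕ.≤-refl

Null : Pred (ℕ → ℚ) 0ℓ
Null s = ∀ ε → 0ℚ ℚ.< ε → Eventually λ n → ℚ.∣ s n ∣ ℚ.< ε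

Bounded : Pred (ℕ → ℚ) 0ℓ
Bounded s = ∃[ K ] 0ℚ ℚ.< K × Eventually λ n → ℚ.∣ s n ∣ ℚ.< K

null-resp : ∀ {s t} → (∀ n → t n ≡ s n) → Null s → Null t
null-resp eq null ε 0<ε =
  eventually-map (λ {n} → subst (λ q → ℚ.∣ q ∣ ℚ.< ε) (sym (eq n))) (null ε 0<ε)

infixr 7 _*₀_
infixr 6 _+₀_

_+₀_ : ∀ {s t} → Null s → Null t → Null (λ n → s n ℚ.+ t n)
_+₀_ {s} {t} s₀ t₀ ε 0<ε =
  eventually-map (λ {n} (a , b) → ∣p+q∣<ε {ε} {s n} {t n} a b)
    (both (s₀ (ε ℚ.* ½) (0<ε/2 0<ε)) (t₀ (ε ℚ.* ½) (0<ε/2 0<ε)))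

null-suc : ∀ {s} → Null s → Null (s ∘ suc)
null-suc s₀ ε 0<ε with s₀ ε 0<ε
... | N , f = N , λ n N≤n → f (suc n) (ℕ.m≤n⇒m≤1+n N≤n)

-- Each square is at most the sum, so a sum below `ε * ε` forces `∣ s n ∣ < ε`.
sum-of-squares-null : ∀ (s t : ℕ → ℚ) → Null (λ n → s n ℚ.* s n ℚ.+ t n ℚ.* t n) → Null s
sum-of-squares-null s t null ε 0<ε with null (ε ℚ.* ε) (0<p*q 0<ε 0<ε)
... | N , f = N , λ n N≤n → ∣p∣<r-from-p*p<r*r 0<ε
  (ℚ.≤-<-trans (p≤p+q*q (s n ℚ.* s n) (t n)) (ℚ.≤-<-trans (p≤∣p∣ (s n ℚ.* s n ℚ.+ t n ℚ.* t n)) (f n N≤n)))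

bounded : ∀ x → Bounded (seq x)
bounded x with cauchy x 1ℚ (ℚ.positive⁻¹ 1ℚ)
... | N , f = K , ℚ.≤-<-trans (ℚ.0≤∣p∣ (seq x N)) (bound N ℕ.≤-refl) , N , bound
  where
  K = 1ℚ ℚ.+ ℚ.∣ seq x N ∣

  eq : ∀ p q → p ≡ (p ℚ.- q) ℚ.+ q
  eq = solve-∀ ℚ-ring

  bound : ∀ n → N ℕ.≤ n → ℚ.∣ seq x n ∣ ℚ.< K
  bound n N≤n = subst (λ q → ℚ.∣ q ∣ ℚ.< K) (sym (eq (seq x n) (seq x N)))
    (ℚ.≤-<-trans (ℚ.∣p+q∣≤∣p∣+∣q∣ (seq x n ℚ.- seq x N) (seq x N))
      (ℚ.+-monoˡ-< ℚ.∣ seq x N ∣ (f n N N≤n ℕ.≤-refl)))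

-- The coefficient is a real and not an arbitrary sequence: being Cauchy, it is bounded by some `K`,
-- and `t` need only get below `ε / K`.
_*₀_ : ∀ x {t} → Null t → Null (λ n → seq x n ℚ.* t n)
_*₀_ x {t} t₀ = null-* (bounded x)
  where
  null-* : Bounded (seq x) → Null (λ n → seq x n ℚ.* t n)
  null-* (K , 0<K , x<K) ε 0<ε = let δ , 0<δ , Kδ≡ε = 1/-scaled 0<K 0<ε in
    eventually-map
      (λ {n} (a , b) → subst (ℚ.∣ seq x n ℚ.* t n ∣ ℚ.<_) Kδ≡ε (∣p*q∣<r*s {seq x n} {t n} a b))
      (both x<K (t₀ δ 0<δ))

const : ℚ → ℝ
const q = mkℝ (λ _ → q) λ ε 0<ε → 0 , λ _ _ _ _ →
  subst (ℚ._< ε) (sym (cong ℚ.∣_∣ (ℚ.+-inverseʳ q))) 0<ε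

-- Reciprocals

BoundedAwayFromZero : Pred ℝ 0ℓ
BoundedAwayFromZero x = ∃[ ε ] 0ℚ ℚ.< ε × Eventually λ n → ε ℚ.≤ ℚ.∣ seq x n ∣

-- Beyond a Cauchy index for `ε / 2`, a single term below `ε / 2` keeps all later terms below `ε`.
-- If this happened for every `ε`, then `x` would be zero; otherwise `ε / 2` is a lower bound.
≉0⇒boundedAwayFromZero : ExcludedMiddle 0ℓ → ∀ x → ¬ x ≈ 0ℝ → BoundedAwayFromZero x
≉0⇒boundedAwayFromZero em x x≉0 with em {BoundedAwayFromZero x}
... | yes away = away
... | no ¬away = contradiction x≈0 x≉0
  where
  eq : ∀ p q → p ℚ.- 0ℚ ≡ (p ℚ.- q) ℚ.+ q
  eq = solve-∀ ℚ-ring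

  x≈0 : x ≈ 0ℝ
  x≈0 ε 0<ε with cauchy x (ε ℚ.* ½) (0<ε/2 0<ε)
  ... | N , f with em {∃[ m ] N ℕ.≤ m × ℚ.∣ seq x m ∣ ℚ.< ε ℚ.* ½}
  ... | no none = contradiction
    (ε ℚ.* ½ , 0<ε/2 0<ε , N , λ n N≤n → ℚ.≮⇒≥ λ xn< → none (n , N≤n , xn<)) ¬away
  ... | yes (m , N≤m , xm<) = N , λ n N≤n →
    subst (λ q → ℚ.∣ q ∣ ℚ.< ε) (sym (eq (seq x n) (seq x m)))
      (∣p+q∣<ε {ε} {seq x n ℚ.- seq x m} {seq x m} (f n m N≤n N≤m) xm<)

-- Total on ℚ, with the junk value recip 0ℚ = 0ℚ.
recip : ℚ → ℚ
recip q with q ℚ.≟ 0ℚ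
... | yes _   = 0ℚ
... | no  q≢0 = (ℚ.1/ q) {{ℚ.≢-nonZero q≢0}}

q*recip : ∀ {q} → 0ℚ ℚ.< ℚ.∣ q ∣ → q ℚ.* recip q ≡ 1ℚ
q*recip {q} 0<∣q∣ with q ℚ.≟ 0ℚ
... | yes q≡0 = contradiction (subst (λ p → 0ℚ ℚ.< ℚ.∣ p ∣) q≡0 0<∣q∣) (ℚ.<-irrefl refl)
... | no  q≢0 = ℚ.*-inverseʳ q {{ℚ.≢-nonZero q≢0}}

-- Reciprocals are taken term by term. They are bounded by some `K`, and 1/p - 1/q = (q - p) / (p q)
-- makes them Cauchy.
reciprocal : ExcludedMiddle 0ℓ → ∀ x → ¬ x ≈ 0ℝ → ∃[ y ] x * y ≈ const 1ℚ
reciprocal em x x≉0 with ≉0⇒boundedAwayFromZero em x x≉0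
-- The 2 makes the bound strict: `ε * ∣ r n ∣ ≤ 1 < 2 = ε * K`.
... | ε , 0<ε , M , ε≤x with 1/-scaled 0<ε {1ℚ ℚ.+ 1ℚ} (ℚ.positive⁻¹ _)
... | K , 0<K , εK≡2 = mkℝ r cr , x*y≈1
  where
  r : ℕ → ℚ
  r n = recip (seq x n)

  xr≡1 : ∀ n → M ℕ.≤ n → seq x n ℚ.* r n ≡ 1ℚ
  xr≡1 n M≤n = q*recip (ℚ.<-≤-trans 0<ε (ε≤x n M≤n))

  r<K : ∀ n → M ℕ.≤ n → ℚ.∣ r n ∣ ℚ.< K
  r<K n M≤n = ℚ.*-cancelˡ-<-nonNeg ε {{ℚ.nonNegative (ℚ.<⇒≤ 0<ε)}} (begin-strict
    ε ℚ.* ℚ.∣ r n ∣               ≤⟨ ℚ.*-monoʳ-≤-nonNeg ℚ.∣ r n ∣ {{ℚ.∣-∣-nonNeg (r n)}} (ε≤x n M≤n) ⟩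
    ℚ.∣ seq x n ∣ ℚ.* ℚ.∣ r n ∣   ≡⟨ ℚ.∣p*q∣≡∣p∣*∣q∣ (seq x n) (r n) ⟨
    ℚ.∣ seq x n ℚ.* r n ∣         ≡⟨ cong ℚ.∣_∣ (xr≡1 n M≤n) ⟩
    1ℚ                            <⟨ ℚ.+-monoʳ-< 1ℚ (ℚ.positive⁻¹ 1ℚ) ⟩
    1ℚ ℚ.+ 1ℚ                     ≡⟨ εK≡2 ⟨
    ε ℚ.* K                       ∎)
    where open ℚ.≤-Reasoning

  difference : ∀ p q s t → p ℚ.* s ≡ 1ℚ → q ℚ.* t ≡ 1ℚ → s ℚ.- t ≡ (s ℚ.* t) ℚ.* (q ℚ.- p)
  difference p q s t ps≡1 qt≡1 = begin
    s ℚ.- t                             ≡⟨ eq₁ s t ⟩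
    s ℚ.* 1ℚ ℚ.- t ℚ.* 1ℚ               ≡⟨ cong₂ (λ a b → s ℚ.* a ℚ.- t ℚ.* b) qt≡1 ps≡1 ⟨
    s ℚ.* (q ℚ.* t) ℚ.- t ℚ.* (p ℚ.* s) ≡⟨ eq₂ p q s t ⟩
    (s ℚ.* t) ℚ.* (q ℚ.- p)             ∎
    where
    open ≡-Reasoning
    eq₁ : ∀ s t → s ℚ.- t ≡ s ℚ.* 1ℚ ℚ.- t ℚ.* 1ℚ
    eq₁ = solve-∀ ℚ-ring
    eq₂ : ∀ p q s t → s ℚ.* (q ℚ.* t) ℚ.- t ℚ.* (p ℚ.* s) ≡ (s ℚ.* t) ℚ.* (q ℚ.- p)
    eq₂ = solve-∀ ℚ-ring

  cr : IsCauchy r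
  cr η 0<η with 1/-scaled (0<p*q 0<K 0<K) 0<η
  ... | δ , 0<δ , KKδ≡η with cauchy x δ 0<δ
  ... | N , f = M ℕ.⊔ N , λ m n ≤m ≤n →
    let M≤m = ℕ.≤-trans (ℕ.m≤m⊔n M N) ≤m
        M≤n = ℕ.≤-trans (ℕ.m≤m⊔n M N) ≤n
        N≤m = ℕ.≤-trans (ℕ.m≤n⊔m M N) ≤m
        N≤n = ℕ.≤-trans (ℕ.m≤n⊔m M N) ≤n
    in subst (ℚ._< η)
      (sym (cong ℚ.∣_∣ (difference (seq x m) (seq x n) (r m) (r n) (xr≡1 m M≤m) (xr≡1 n M≤n))))
      (subst (_ ℚ.<_) KKδ≡η
        (∣p*q∣<r*s {r m ℚ.* r n} (∣p*q∣<r*s {r m} {r n} (r<K m M≤m) (r<K n M≤n)) (f n m N≤n N≤m)))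

  x*y≈1 : ∀ η → 0ℚ ℚ.< η → Eventually λ n → ℚ.∣ seq x n ℚ.* r n ℚ.- 1ℚ ∣ ℚ.< η
  x*y≈1 η 0<η = M , λ n M≤n →
    subst (λ q → ℚ.∣ q ℚ.- 1ℚ ∣ ℚ.< η) (sym (xr≡1 n M≤n)) 0<η

-- Base-four expansions with digits 0 and 2

¼ : ℚ
¼ = ½ ℚ.* ½

1/[1+_] : ℕ → ℚ
1/[1+ n ] = ℚ.mkℚ (ℤ.+ 1) n (1-coprimeTo (suc n))

-- For ε = (a + 1) / (d + 1) the witness `suc d` works, because 1 / (d + 2) < 1 / (d + 1) ≤ ε.
1/[1+n]<ε : ∀ ε → 0ℚ ℚ.< ε → ∃[ n ] 1/[1+ n ] ℚ.< ε
1/[1+n]<ε (ℚ.mkℚ (ℤ.+ zero)  d c) 0<ε = contradiction (ℚ.positive 0<ε) λ ()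
1/[1+n]<ε (ℚ.mkℚ ℤ.-[1+ _ ]  d c) 0<ε = contradiction (ℚ.positive 0<ε) λ ()
1/[1+n]<ε (ℚ.mkℚ (ℤ.+ suc a) d c) 0<ε = suc d , ℚ.*<* (ℤ.+<+ (begin-strict
  1 ℕ.* suc d           ≡⟨ ℕ.*-identityˡ (suc d) ⟩
  suc d                 <⟨ ℕ.n<1+n (suc d) ⟩
  suc (suc d)           ≤⟨ ℕ.m≤n*m (suc (suc d)) (suc a) ⟩
  suc a ℕ.* suc (suc d) ∎))
  where open ℕ.≤-Reasoning

-- Since n + 2 ≤ 4 (n + 1). By induction the geometric error of an expansion is dominated by
-- `1/[1+ n ]`, which is easy to push below any `ε`.
¼*1/[1+n]≤ : ∀ n → ¼ ℚ.* 1/[1+ n ] ℚ.≤ 1/[1+ suc n ]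
¼*1/[1+n]≤ n = ℚ.toℚᵘ-cancel-≤ (begin
  ℚ.toℚᵘ (¼ ℚ.* 1/[1+ n ])           ≃⟨ ℚ.toℚᵘ-homo-* ¼ 1/[1+ n ] ⟩
  ℚ.toℚᵘ ¼ ℚᵘ.* ℚ.toℚᵘ 1/[1+ n ]     ≤⟨ ℚᵘ.*≤* (ℤ.+≤+ (ℕ.*-monoʳ-≤ 1 (ℕ.s≤s
                                          (ℕ.≤-trans (ℕ.m≤m+n (suc n) _) (ℕ.m≤n+m _ n))))) ⟩
  ℚ.toℚᵘ 1/[1+ suc n ]               ∎)
  where open ℚᵘ.≤-Reasoning

-- The digit is already divided by the base: ½ is 2/4.
digit : Bool → ℚ
digit true  = ½
digit false = 0ℚ

expansion : (ℕ → Bool) → ℕ → ℚ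
expansion a zero    = 0ℚ
expansion a (suc n) = digit (a 0) ℚ.+ ¼ ℚ.* expansion (a ∘ suc) n

0≤expansion : ∀ a n → 0ℚ ℚ.≤ expansion a n
0≤expansion a zero    = ℚ.≤-refl
0≤expansion a (suc n) =
  ℚ.+-mono-≤ (0≤digit (a 0)) (ℚ.*-monoˡ-≤-nonNeg ¼ (0≤expansion (a ∘ suc) n))
  where
  0≤digit : ∀ b → 0ℚ ℚ.≤ digit b
  0≤digit true  = ℚ.nonNegative⁻¹ ½
  0≤digit false = ℚ.≤-refl

-- The bound 1 reproduces itself, as ½ + ¼ · 1 ≤ 1.
expansion≤1 : ∀ a n → expansion a n ℚ.≤ 1ℚ
expansion≤1 a zero    = ℚ.nonNegative⁻¹ 1ℚ
expansion≤1 a (suc n) = ℚ.≤-trans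
  (ℚ.+-mono-≤ (digit≤½ (a 0)) (ℚ.*-monoˡ-≤-nonNeg ¼ (expansion≤1 (a ∘ suc) n)))
  (ℚ.≤ᵇ⇒≤ _)
  where
  digit≤½ : ∀ b → digit b ℚ.≤ ½
  digit≤½ true  = ℚ.≤-refl
  digit≤½ false = ℚ.nonNegative⁻¹ ½

∣p-q∣≤1 : ∀ {p q} → 0ℚ ℚ.≤ p → p ℚ.≤ 1ℚ → 0ℚ ℚ.≤ q → q ℚ.≤ 1ℚ → ℚ.∣ p ℚ.- q ∣ ℚ.≤ 1ℚ
∣p-q∣≤1 {p} {q} 0≤p p≤1 0≤q q≤1 with ℚ.∣p∣≡p∨∣p∣≡-p (p ℚ.- q)
... | inj₁ eq = subst (ℚ._≤ 1ℚ) (sym eq) (ℚ.+-mono-≤ p≤1 (ℚ.neg-antimono-≤ 0≤q))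
... | inj₂ eq = subst (ℚ._≤ 1ℚ) (sym (trans eq (-[p-q]≡q-p p q)))
  (ℚ.+-mono-≤ q≤1 (ℚ.neg-antimono-≤ 0≤p))

expansion-step : ∀ d p q → (d ℚ.+ ¼ ℚ.* p) ℚ.- (d ℚ.+ ¼ ℚ.* q) ≡ ¼ ℚ.* (p ℚ.- q)
expansion-step = solve-∀ ℚ-ring

-- Removing the common leading digit leaves a quarter of the difference of the tails, so the
-- induction is on the number `N` of shared digits.
expansion-close : ∀ N a m n → N ℕ.≤ m → N ℕ.≤ n →
  ℚ.∣ expansion a m ℚ.- expansion a n ∣ ℚ.≤ 1/[1+ N ]
expansion-close zero a m n _ _ =
  ∣p-q∣≤1 (0≤expansion a m) (expansion≤1 a m) (0≤expansion a n) (expansion≤1 a n)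
expansion-close (suc N) a (suc m) (suc n) (ℕ.s≤s N≤m) (ℕ.s≤s N≤n) = begin
  ℚ.∣ expansion a (suc m) ℚ.- expansion a (suc n) ∣ ≡⟨ cong ℚ.∣_∣ (expansion-step (digit (a 0)) x y) ⟩
  ℚ.∣ ¼ ℚ.* (x ℚ.- y) ∣                             ≡⟨ ℚ.∣p*q∣≡∣p∣*∣q∣ ¼ (x ℚ.- y) ⟩
  ¼ ℚ.* ℚ.∣ x ℚ.- y ∣                               ≤⟨ ℚ.*-monoˡ-≤-nonNeg ¼ (expansion-close N (a ∘ suc) m n N≤m N≤n) ⟩
  ¼ ℚ.* 1/[1+ N ]                                   ≤⟨ ¼*1/[1+n]≤ N ⟩
  1/[1+ suc N ]                                     ∎
  where
  open ℚ.≤-Reasoning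
  x = expansion (a ∘ suc) m
  y = expansion (a ∘ suc) n

expansionℝ : (ℕ → Bool) → ℝ
expansionℝ a = mkℝ (expansion a) λ ε 0<ε → let N , 1/N<ε = 1/[1+n]<ε ε 0<ε in
  N , λ m n N≤m N≤n → ℚ.≤-<-trans (expansion-close N a m n N≤m N≤n) 1/N<ε

-- From the first digit on, the terms for `a` are at least ½ and those for `b` at most ¼. Leaving
-- out the digits 1 and 3 creates this gap, so no two expansions name the same real.
head-determined : ∀ {a b} → a 0 ≡ true → b 0 ≡ false → ¬ expansionℝ a ≈ expansionℝ b
head-determined {a} {b} a₀ b₀ a≈b with a≈b ¼ (ℚ.positive⁻¹ ¼)
... | N , f = ℚ.<-irrefl refl (ℚ.<-≤-trans (f (suc N) (ℕ.n≤1+n N)) (ℚ.≤-trans gap (p≤∣p∣ _)))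
  where
  gap : ¼ ℚ.≤ expansion a (suc N) ℚ.- expansion b (suc N)
  gap = ℚ.+-mono-≤
    (subst (λ c → ½ ℚ.≤ digit c ℚ.+ ¼ ℚ.* x) (sym a₀)
      (ℚ.+-monoʳ-≤ ½ (ℚ.*-monoˡ-≤-nonNeg ¼ (0≤expansion (a ∘ suc) N))))
    (ℚ.neg-antimono-≤ (subst (λ c → digit c ℚ.+ ¼ ℚ.* y ℚ.≤ ¼) (sym b₀)
      (ℚ.+-monoʳ-≤ 0ℚ (ℚ.*-monoˡ-≤-nonNeg ¼ (expansion≤1 (b ∘ suc) N)))))
    where
    x = expansion (a ∘ suc) N
    y = expansion (b ∘ suc) N

-- The common leading digit cancels, and multiplying by 4 undoes the shift of the tail.
tails-determined : ∀ {a b} → a 0 ≡ b 0 → expansionℝ a ≈ expansionℝ b →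
  expansionℝ (a ∘ suc) ≈ expansionℝ (b ∘ suc)
tails-determined {a} {b} a₀≡b₀ a≈b = null-resp
  (λ n → trans (eq (digit (a 0)) (expansion (a ∘ suc) n) (expansion (b ∘ suc) n))
    (cong (λ c → 4ℚ ℚ.* (expansion a (suc n) ℚ.- (digit c ℚ.+ ¼ ℚ.* expansion (b ∘ suc) n))) a₀≡b₀))
  (const 4ℚ *₀ null-suc a≈b)
  where
  4ℚ = ℚ.1/ ¼
  eq : ∀ d p q → p ℚ.- q ≡ 4ℚ ℚ.* ((d ℚ.+ ¼ ℚ.* p) ℚ.- (d ℚ.+ ¼ ℚ.* q))
  eq = solve-∀ ℚ-ring

expansionℝ-injective : ∀ n {a b} → expansionℝ a ≈ expansionℝ b → a n ≡ b n
expansionℝ-injective zero {a} {b} a≈b with a 0 in a₀ | b 0 in b₀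
... | true  | true  = refl
... | false | false = refl
... | true  | false = contradiction a≈b (head-determined a₀ b₀)
... | false | true  = contradiction (≈-sym {expansionℝ a} {expansionℝ b} a≈b) (head-determined b₀ a₀)
expansionℝ-injective (suc n) a≈b =
  expansionℝ-injective n (tails-determined (expansionℝ-injective 0 a≈b) a≈b)

-- The diagonal is true at `n` exactly when some preimage of `n` is false at `n`, so `h` need not be
-- inverted. At `h diagonal`, injectivity identifies every preimage with `diagonal` pointwise, and
-- either value is contradictory.
cantor : ExcludedMiddle 0ℓ → (h : (ℕ → Bool) → ℕ) → ¬ (∀ {a b} → h a ≡ h b → ∀ n → a n ≡ b n)
cantor em h injective = ¬missing (diagonal , refl , dec-false em ¬missing)
  where
  Missing : ℕ → Set
  Missing n = ∃[ a ] h a ≡ n × a n ≡ false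

  diagonal : ℕ → Bool
  diagonal n = does (em {Missing n})

  ¬missing : ¬ Missing (h diagonal)
  ¬missing missing@(a , ha≡ , a≡false)
    with () ← trans (sym a≡false) (trans (injective ha≡ (h diagonal)) (dec-true em missing))

-- The Euclidean plane

infixl 6 _⊖_

_⊖_ : ℝ² → ℝ² → ℝ²
(x₁ , y₁) ⊖ (x₂ , y₂) = (x₁ - x₂) , (y₁ - y₂)

∥_∥² : ℝ² → ℝ
∥ x , y ∥² = x * x + y * y

≉⇒∥q⊖p∥²≉0 : ∀ p q → ¬ p ≈₂ q → ¬ ∥ q ⊖ p ∥² ≈ 0ℝ
≉⇒∥q⊖p∥²≉0 (p₁ , p₂) (q₁ , q₂) p≉q null = p≉q
  ( ≈-sym {q₁} {p₁} (sum-of-squares-null (seq (q₁ - p₁)) (seq (q₂ - p₂)) (null-resp (λ n → eq₁ (seq (q₁ - p₁) n) (seq (q₂ - p₂) n)) null))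
  , ≈-sym {q₂} {p₂} (sum-of-squares-null (seq (q₂ - p₂)) (seq (q₁ - p₁)) (null-resp (λ n → eq₂ (seq (q₂ - p₂) n) (seq (q₁ - p₁) n)) null)))
  where
  eq₁ : ∀ x y → x ℚ.* x ℚ.+ y ℚ.* y ≡ x ℚ.* x ℚ.+ y ℚ.* y ℚ.- 0ℚ
  eq₁ = solve-∀ ℚ-ring
  eq₂ : ∀ y x → y ℚ.* y ℚ.+ x ℚ.* x ≡ x ℚ.* x ℚ.+ y ℚ.* y ℚ.- 0ℚ
  eq₂ = solve-∀ ℚ-ring

-- Read 1 as a square: a null sum of squares would make the constant sequence 1 null.
1+t*t≉0 : ∀ t → ¬ const 1ℚ + t * t ≈ 0ℝ
1+t*t≉0 t null = ℚ.<-irrefl refl (eventually-const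
  (sum-of-squares-null (λ _ → 1ℚ) (seq t) (null-resp (λ n → eq (seq t n)) null) 1ℚ (ℚ.positive⁻¹ 1ℚ)))
  where
  eq : ∀ t → 1ℚ ℚ.* 1ℚ ℚ.+ t ℚ.* t ≡ 1ℚ ℚ.+ t ℚ.* t ℚ.- 0ℚ
  eq = solve-∀ ℚ-ring

-- The parameter `c` is the squared radius, which avoids square roots.
Circle : ℝ² → ℝ → Pred ℝ² 0ℓ
Circle b c z = ∥ z ⊖ b ∥² ≈ c

-- The complement of a circle is open

-ε<p : ∀ {ε p} → ℚ.∣ p ∣ ℚ.< ε → ℚ.- ε ℚ.< p
-ε<p {ε} {p} p<ε = subst (ℚ.- ε ℚ.<_) (neg-neg p) (ℚ.neg-antimono-< (ℚ.≤-<-trans (-p≤∣p∣ p) p<ε))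

-- The hypothesis is a negation. One late term above `- (ε / 2)` keeps the later ones above `- ε`;
-- if there is none, then `x` is strictly negative.
0≤⇒eventually-ε< : ExcludedMiddle 0ℓ → ∀ x → 0ℝ ≤ x → ∀ ε → 0ℚ ℚ.< ε →
  Eventually λ n → ℚ.- ε ℚ.< seq x n
0≤⇒eventually-ε< em x 0≤x ε 0<ε with cauchy x (ε ℚ.* ½) (0<ε/2 0<ε)
... | N , f with em {∃[ m ] N ℕ.≤ m × ℚ.- (ε ℚ.* ½) ℚ.< seq x m}
... | yes (m , N≤m , xm>) = N , λ n N≤n →
  subst₂ ℚ._<_ (eq₁ ε) (eq₂ (seq x m) (seq x n)) (ℚ.+-mono-< xm> (-ε<p (f n m N≤n N≤m)))
  where
  eq₁ : ∀ ε → ℚ.- (ε ℚ.* ½) ℚ.+ ℚ.- (ε ℚ.* ½) ≡ ℚ.- ε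
  eq₁ = solve-∀ ℚ-ring
  eq₂ : ∀ p q → p ℚ.+ (q ℚ.- p) ≡ q
  eq₂ = solve-∀ ℚ-ring
... | no none = contradiction x<0 0≤x
  where
  -- All late terms are at most `- (ε / 2)`, so adding ε/4 still leaves them at most -ε/4.
  η = ε ℚ.* ½ ℚ.* ½
  0<η = 0<ε/2 (0<ε/2 0<ε)
  eq : ∀ δ → ℚ.- δ ℚ.+ δ ℚ.* ½ ≡ ℚ.- (δ ℚ.* ½)
  eq = solve-∀ ℚ-ring
  x<0 : x < 0ℝ
  x<0 = η , 0<η , N , λ n N≤n → ℚ.≤-<-trans
    (ℚ.+-monoˡ-≤ η (ℚ.≮⇒≥ λ xn> → none (n , N≤n , xn>)))
    (subst (ℚ._< 0ℚ) (sym (eq (ε ℚ.* ½))) (ℚ.neg-antimono-< 0<η))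

-- The radius is half of the tolerance: squared distances below (δ / 2)² leave
-- room 3 (δ / 2)² for the error in d² ≈ ∥ p ⊖ q ∥².
Ball-coordinates : ExcludedMiddle 0ℓ → ∀ p q δ → 0ℚ ℚ.< δ → Ball p (const (δ ℚ.* ½)) q →
  Eventually λ n → ℚ.∣ seq (proj₁ (p ⊖ q)) n ∣ ℚ.< δ × ℚ.∣ seq (proj₂ (p ⊖ q)) n ∣ ℚ.< δ
Ball-coordinates em p q δ 0<δ (d , (0≤d , d²≈) , (ε , 0<ε , d<r)) =
  eventually-map coordinates
    (both (both (0≤⇒eventually-ε< em d 0≤d r 0<r) d<r) (d²≈ (3ℚ ℚ.* (r ℚ.* r)) (0<p*q (ℚ.positive⁻¹ 3ℚ) (0<p*q 0<r 0<r))))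
  where
  3ℚ = 1ℚ ℚ.+ 1ℚ ℚ.+ 1ℚ
  r = δ ℚ.* ½
  0<r = 0<ε/2 0<δ

  eq₁ : ∀ s t → s ℚ.+ ℚ.- (s ℚ.- t) ≡ t
  eq₁ = solve-∀ ℚ-ring
  eq₂ : ∀ δ → δ ℚ.* ½ ℚ.* (δ ℚ.* ½) ℚ.+ 3ℚ ℚ.* (δ ℚ.* ½ ℚ.* (δ ℚ.* ½)) ≡ δ ℚ.* δ
  eq₂ = solve-∀ ℚ-ring

  sum-of-squares< : ∀ d u → ℚ.- r ℚ.< d → d ℚ.+ ε ℚ.< r → ℚ.∣ d ℚ.* d ℚ.- u ∣ ℚ.< 3ℚ ℚ.* (r ℚ.* r) → u ℚ.< δ ℚ.* δ
  sum-of-squares< d u -r<d d+ε<r close = subst₂ ℚ._<_ (eq₁ (d ℚ.* d) u) (eq₂ δ)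
    (ℚ.+-mono-<
      (ℚ.≤-<-trans (p≤∣p∣ (d ℚ.* d)) (∣p*q∣<r*s {d} {d} ∣d∣<r ∣d∣<r))
      (ℚ.≤-<-trans (-p≤∣p∣ (d ℚ.* d ℚ.- u)) close))
    where
    ∣d∣<r : ℚ.∣ d ∣ ℚ.< r
    ∣d∣<r = ∣p∣<r -r<d (ℚ.<-trans
      (subst (ℚ._< d ℚ.+ ε) (ℚ.+-identityʳ d) (ℚ.+-monoʳ-< d 0<ε)) d+ε<r)

  coordinates : ∀ {n} → _ → ℚ.∣ seq (proj₁ (p ⊖ q)) n ∣ ℚ.< δ × ℚ.∣ seq (proj₂ (p ⊖ q)) n ∣ ℚ.< δ
  coordinates {n} ((-r<d , d+ε<r) , close) =
      ∣p∣<r-from-p*p<r*r 0<δ (ℚ.≤-<-trans (p≤p+q*q (u₁ ℚ.* u₁) u₂) total)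
    , ∣p∣<r-from-p*p<r*r 0<δ (ℚ.≤-<-trans (p≤p+q*q (u₂ ℚ.* u₂) u₁)
        (subst (ℚ._< δ ℚ.* δ) (ℚ.+-comm (u₁ ℚ.* u₁) (u₂ ℚ.* u₂)) total))
    where
    u₁ = seq (proj₁ (p ⊖ q)) n
    u₂ = seq (proj₂ (p ⊖ q)) n
    total : u₁ ℚ.* u₁ ℚ.+ u₂ ℚ.* u₂ ℚ.< δ ℚ.* δ
    total = sum-of-squares< (seq d n) (u₁ ℚ.* u₁ ℚ.+ u₂ ℚ.* u₂) -r<d d+ε<r close

lower-bound : ∀ {p q} → 0ℚ ℚ.< p → 0ℚ ℚ.< q → ∃[ r ] 0ℚ ℚ.< r × r ℚ.≤ p × r ℚ.≤ q
lower-bound {p} {q} 0<p 0<q with ℚ.≤-total p q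
... | inj₁ p≤q = p , 0<p , ℚ.≤-refl , p≤q
... | inj₂ q≤p = q , 0<q , q≤p , ℚ.≤-refl

-- Take δ at most both 1 and η / (K + 1); then ∣u∣ (∣v∣ + ∣u∣) < δ (K + 1) ≤ η. The product is the
-- change of a squared coordinate in `square-shift`.
u*[v-u]-small : ∀ {K} → 0ℚ ℚ.< K → ∀ {η} → 0ℚ ℚ.< η →
  ∃[ δ ] 0ℚ ℚ.< δ × (∀ u v → ℚ.∣ u ∣ ℚ.< δ → ℚ.∣ v ∣ ℚ.< K → ℚ.∣ u ℚ.* (v ℚ.- u) ∣ ℚ.< η)
u*[v-u]-small {K} 0<K {η} 0<η
  with 1/-scaled {K ℚ.+ 1ℚ} (ℚ.<-trans 0<K K<K+1) 0<η
  where
  K<K+1 = subst (ℚ._< K ℚ.+ 1ℚ) (ℚ.+-identityʳ K) (ℚ.+-monoʳ-< K (ℚ.positive⁻¹ 1ℚ))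
... | δ₀ , 0<δ₀ , [K+1]δ₀≡η with lower-bound 0<δ₀ (ℚ.positive⁻¹ 1ℚ)
... | δ , 0<δ , δ≤δ₀ , δ≤1 = δ , 0<δ , λ u v u<δ v<K →
  subst (ℚ.∣ u ℚ.* (v ℚ.- u) ∣ ℚ.<_) (trans (ℚ.*-comm δ₀ (K ℚ.+ 1ℚ)) [K+1]δ₀≡η)
    (∣p*q∣<r*s {u} {v ℚ.- u} (ℚ.<-≤-trans u<δ δ≤δ₀)
      (ℚ.≤-<-trans (ℚ.∣p-q∣≤∣p∣+∣q∣ v u) (ℚ.+-mono-< v<K (ℚ.<-≤-trans u<δ δ≤1))))

0<const : ∀ {q} → 0ℚ ℚ.< q → 0ℝ < const q
0<const {q} 0<q = q ℚ.* ½ , 0<ε/2 0<q , 0 , λ _ _ →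
  subst (0ℚ ℚ.+ q ℚ.* ½ ℚ.<_) (ε/2+ε/2≡ε q) (ℚ.+-monoˡ-< (q ℚ.* ½) (0<ε/2 0<q))

-- Off the circle, `∥ p ⊖ b ∥² - c` is eventually at least some `ε` in absolute value. Moving `p` to
-- a nearby `q` changes it by less than `ε / 2`, so it cannot become null.
∁Circle-isOpen : ExcludedMiddle 0ℓ → ∀ b c → IsOpen (∁ (Circle b c))
∁Circle-isOpen em b@(b₁ , b₂) c {p@(p₁ , p₂)} p∉ = neighbourhood
  (≉0⇒boundedAwayFromZero em (∥ p ⊖ b ∥² - c) λ null →
    p∉ (null-resp (λ n → p≡p-0 (seq (∥ p ⊖ b ∥² - c) n)) null))
  (bounded v₁) (bounded v₂)
  where
  v₁ = (p₁ - b₁) + (p₁ - b₁)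
  v₂ = (p₂ - b₂) + (p₂ - b₂)

  p≡p-0 : ∀ p → p ≡ p ℚ.- 0ℚ
  p≡p-0 = solve-∀ ℚ-ring

  -- With u = p - q the correction is u (2 (p - b) - u); the doubled terms are `v₁` and `v₂`.
  square-shift : ∀ p q b → (p ℚ.- b) ℚ.* (p ℚ.- b) ≡
    (q ℚ.- b) ℚ.* (q ℚ.- b) ℚ.+ (p ℚ.- q) ℚ.* ((p ℚ.- b) ℚ.+ (p ℚ.- b) ℚ.- (p ℚ.- q))
  square-shift = solve-∀ ℚ-ring

  regroup : ∀ x₁ y₁ x₂ y₂ c →
    (x₁ ℚ.+ y₁) ℚ.+ (x₂ ℚ.+ y₂) ℚ.- c ≡ (x₁ ℚ.+ x₂ ℚ.- c) ℚ.+ (y₁ ℚ.+ y₂)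
  regroup = solve-∀ ℚ-ring

  neighbourhood : BoundedAwayFromZero (∥ p ⊖ b ∥² - c) → Bounded (seq v₁) → Bounded (seq v₂) →
    ∃[ r ] 0ℝ < r × Ball p r ⊆ ∁ (Circle b c)
  neighbourhood (ε , 0<ε , away) (K₁ , 0<K₁ , v₁<K₁) (K₂ , 0<K₂ , v₂<K₂) =
    const (δ ℚ.* ½) , 0<const (0<ε/2 0<δ) , λ {q} ball q∈ →
      eventually-const (eventually-map (λ {n} (near , far) → absurd q n near far)
        (both (both (Ball-coordinates em p q δ 0<δ ball) (both v₁<K₁ v₂<K₂))
          (both away (q∈ (ε ℚ.* ½) (0<ε/2 0<ε)))))
    where
    -- Each coordinate contributes less than ε/4; the remaining ε/2 is for the point `q` on the
    -- circle.
    small₁ = u*[v-u]-small 0<K₁ (0<ε/2 (0<ε/2 0<ε))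
    small₂ = u*[v-u]-small 0<K₂ (0<ε/2 (0<ε/2 0<ε))
    common = lower-bound (proj₁ (proj₂ small₁)) (proj₁ (proj₂ small₂))
    δ = proj₁ common
    0<δ = proj₁ (proj₂ common)
    δ≤δ₁ = proj₁ (proj₂ (proj₂ common))
    δ≤δ₂ = proj₂ (proj₂ (proj₂ common))

    absurd : ∀ q n →
      (ℚ.∣ seq (proj₁ (p ⊖ q)) n ∣ ℚ.< δ × ℚ.∣ seq (proj₂ (p ⊖ q)) n ∣ ℚ.< δ) ×
      (ℚ.∣ seq v₁ n ∣ ℚ.< K₁ × ℚ.∣ seq v₂ n ∣ ℚ.< K₂) →
      ε ℚ.≤ ℚ.∣ seq (∥ p ⊖ b ∥² - c) n ∣ × ℚ.∣ seq (∥ q ⊖ b ∥² - c) n ∣ ℚ.< ε ℚ.* ½ →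
      ⊥
    absurd (q₁ , q₂) n ((u₁<δ , u₂<δ) , (v₁< , v₂<)) (ε≤ , q<) =
      ℚ.<-irrefl refl (ℚ.<-≤-trans
        (subst (λ x → ℚ.∣ x ∣ ℚ.< ε)
          (sym (trans
            (cong₂ (λ x y → x ℚ.+ y ℚ.- seq c n)
              (square-shift (seq p₁ n) (seq q₁ n) (seq b₁ n))
              (square-shift (seq p₂ n) (seq q₂ n) (seq b₂ n)))
            (regroup (seq ((q₁ - b₁) * (q₁ - b₁)) n) (u₁ ℚ.* (w₁ ℚ.- u₁))
              (seq ((q₂ - b₂) * (q₂ - b₂)) n) (u₂ ℚ.* (w₂ ℚ.- u₂)) (seq c n))))
          (∣p+q∣<ε {ε} {seq (∥ (q₁ , q₂) ⊖ b ∥² - c) n} q<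
            (∣p+q∣<ε {ε ℚ.* ½} {u₁ ℚ.* (w₁ ℚ.- u₁)}
              (proj₂ (proj₂ small₁) u₁ w₁ (ℚ.<-≤-trans u₁<δ δ≤δ₁) v₁<)
              (proj₂ (proj₂ small₂) u₂ w₂ (ℚ.<-≤-trans u₂<δ δ≤δ₂) v₂<))))
        ε≤)
      where
      u₁ = seq (p₁ - q₁) n
      u₂ = seq (p₂ - q₂) n
      w₁ = seq v₁ n
      w₂ = seq v₂ n

-- Excluded middle identifies the circle with the complement of its open complement.
Circle-Borel : ExcludedMiddle 0ℓ → ∀ b c → Borel (Circle b c)
Circle-Borel em b c = resp-≐
  (decidable-stable em , λ z∈ z∉ → z∉ z∈)
  (complement (isOpen λ {p} → ∁Circle-isOpen em b c {p}))

-- Rotations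

infixl 6 _⊕_
infixl 7 _⊙_

_⊕_ : ℝ² → ℝ² → ℝ²
(x₁ , y₁) ⊕ (x₂ , y₂) = (x₁ + x₂) , (y₁ + y₂)

-- Complex multiplication.
_⊙_ : ℝ² → ℝ² → ℝ²
(x₁ , y₁) ⊙ (x₂ , y₂) = (x₁ * x₂ - y₁ * y₂) , (x₁ * y₂ + y₁ * x₂)

rotate : (w a b z : ℝ²) → ℝ²
rotate w a b z = b ⊕ w ⊙ (z ⊖ a)

-- The squared norm is multiplicative, so the difference is `∥ u ∥²` times `∥ w ∥² - 1`.
∥w⊙u∥²≈∥u∥² : ∀ w u → ∥ w ∥² ≈ const 1ℚ → ∥ w ⊙ u ∥² ≈ ∥ u ∥²
∥w⊙u∥²≈∥u∥² w@(w₁ , w₂) u@(u₁ , u₂) ∥w∥²≈1 = null-resp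
  (λ n → identity (seq w₁ n) (seq w₂ n) (seq u₁ n) (seq u₂ n))
  (∥ u ∥² *₀ ∥w∥²≈1)
  where
  identity : ∀ w₁ w₂ u₁ u₂ →
    (w₁ ℚ.* u₁ ℚ.- w₂ ℚ.* u₂) ℚ.* (w₁ ℚ.* u₁ ℚ.- w₂ ℚ.* u₂) ℚ.+
    (w₁ ℚ.* u₂ ℚ.+ w₂ ℚ.* u₁) ℚ.* (w₁ ℚ.* u₂ ℚ.+ w₂ ℚ.* u₁) ℚ.-
    (u₁ ℚ.* u₁ ℚ.+ u₂ ℚ.* u₂) ≡
    (u₁ ℚ.* u₁ ℚ.+ u₂ ℚ.* u₂) ℚ.* (w₁ ℚ.* w₁ ℚ.+ w₂ ℚ.* w₂ ℚ.- 1ℚ)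
  identity = solve-∀ ℚ-ring

pointwise : ∀ {x y} → (∀ n → seq x n ≡ seq y n) → x ≈ y
pointwise {x} {y} eq = null-resp {s = λ _ → 0ℚ}
  (λ n → trans (cong (ℚ._- seq y n) (eq n)) (ℚ.+-inverseʳ (seq y n)))
  (λ ε 0<ε → 0 , λ _ _ → 0<ε)

infix 4 _≗_

-- Polynomial identities between points hold for every term of the sequences, with no limit
-- involved.
_≗_ : ℝ² → ℝ² → Set
(x₁ , x₂) ≗ (y₁ , y₂) = ∀ n → seq x₁ n ≡ seq y₁ n × seq x₂ n ≡ seq y₂ n

∥∥²-cong-≗ : ∀ x y → x ≗ y → ∥ x ∥² ≈ ∥ y ∥²
∥∥²-cong-≗ x y eq = pointwise {∥ x ∥²} {∥ y ∥²}
  (λ n → cong₂ (λ p q → p ℚ.* p ℚ.+ q ℚ.* q) (proj₁ (eq n)) (proj₂ (eq n)))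

rotate-difference : ∀ w a b x y → rotate w a b x ⊖ rotate w a b y ≗ w ⊙ (x ⊖ y)
rotate-difference (w₁ , w₂) (a₁ , a₂) (b₁ , b₂) (x₁ , x₂) (y₁ , y₂) n =
    eq₁ (seq w₁ n) (seq w₂ n) (seq a₁ n) (seq a₂ n) (seq b₁ n) (seq x₁ n) (seq x₂ n) (seq y₁ n) (seq y₂ n)
  , eq₂ (seq w₁ n) (seq w₂ n) (seq a₁ n) (seq a₂ n) (seq b₂ n) (seq x₁ n) (seq x₂ n) (seq y₁ n) (seq y₂ n)
  where
  eq₁ : ∀ w₁ w₂ a₁ a₂ b₁ x₁ x₂ y₁ y₂ →
    (b₁ ℚ.+ (w₁ ℚ.* (x₁ ℚ.- a₁) ℚ.- w₂ ℚ.* (x₂ ℚ.- a₂))) ℚ.-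
    (b₁ ℚ.+ (w₁ ℚ.* (y₁ ℚ.- a₁) ℚ.- w₂ ℚ.* (y₂ ℚ.- a₂))) ≡
    w₁ ℚ.* (x₁ ℚ.- y₁) ℚ.- w₂ ℚ.* (x₂ ℚ.- y₂)
  eq₁ = solve-∀ ℚ-ring
  eq₂ : ∀ w₁ w₂ a₁ a₂ b₂ x₁ x₂ y₁ y₂ →
    (b₂ ℚ.+ (w₁ ℚ.* (x₂ ℚ.- a₂) ℚ.+ w₂ ℚ.* (x₁ ℚ.- a₁))) ℚ.-
    (b₂ ℚ.+ (w₁ ℚ.* (y₂ ℚ.- a₂) ℚ.+ w₂ ℚ.* (y₁ ℚ.- a₁))) ≡
    w₁ ℚ.* (x₂ ℚ.- y₂) ℚ.+ w₂ ℚ.* (x₁ ℚ.- y₁)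
  eq₂ = solve-∀ ℚ-ring

rotate-preserves-∥∥² : ∀ w a b x y → ∥ w ∥² ≈ const 1ℚ →
  ∥ rotate w a b x ⊖ rotate w a b y ∥² ≈ ∥ x ⊖ y ∥²
rotate-preserves-∥∥² w a b x y ∥w∥²≈1 =
  ≈-trans {∥ rotate w a b x ⊖ rotate w a b y ∥²} {∥ w ⊙ (x ⊖ y) ∥²} {∥ x ⊖ y ∥²}
    (∥∥²-cong-≗ (rotate w a b x ⊖ rotate w a b y) (w ⊙ (x ⊖ y)) (rotate-difference w a b x y))
    (∥w⊙u∥²≈∥u∥² w (x ⊖ y) ∥w∥²≈1)

rotate-cong : ∀ w a b x y → x ≈₂ y → rotate w a b x ≈₂ rotate w a b y
rotate-cong w@(w₁ , w₂) a b x@(x₁ , x₂) y@(y₁ , y₂) (x₁≈y₁ , x₂≈y₂) =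
    null-resp
      (λ n → trans (proj₁ (rotate-difference w a b x y n))
        (cong (seq (w₁ * (x₁ - y₁)) n ℚ.+_) (ℚ.neg-distribˡ-* (seq w₂ n) (seq (x₂ - y₂) n))))
      (w₁ *₀ x₁≈y₁ +₀ (- w₂) *₀ x₂≈y₂)
  , null-resp (λ n → proj₂ (rotate-difference w a b x y n))
      (w₁ *₀ x₂≈y₂ +₀ w₂ *₀ x₁≈y₁)

conjugate : ℝ² → ℝ²
conjugate (x , y) = x , - y

-- A unit complex number has its conjugate as inverse, and swapping the centres undoes the
-- translation.
rotate-conjugate : ∀ w a b y → ∥ w ∥² ≈ const 1ℚ →
  rotate w a b (rotate (conjugate w) b a y) ≈₂ y
rotate-conjugate (w₁ , w₂) (a₁ , a₂) (b₁ , b₂) (y₁ , y₂) ∥w∥²≈1 =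
    null-resp (λ n → eq₁ (seq w₁ n) (seq w₂ n) (seq a₁ n) (seq a₂ n) (seq b₁ n) (seq b₂ n) (seq y₁ n) (seq y₂ n))
      ((y₁ - b₁) *₀ ∥w∥²≈1)
  , null-resp (λ n → eq₂ (seq w₁ n) (seq w₂ n) (seq a₁ n) (seq a₂ n) (seq b₁ n) (seq b₂ n) (seq y₁ n) (seq y₂ n))
      ((y₂ - b₂) *₀ ∥w∥²≈1)
  where
  eq₁ : ∀ w₁ w₂ a₁ a₂ b₁ b₂ y₁ y₂ →
    (b₁ ℚ.+ (w₁ ℚ.* ((a₁ ℚ.+ (w₁ ℚ.* (y₁ ℚ.- b₁) ℚ.- (ℚ.- w₂) ℚ.* (y₂ ℚ.- b₂))) ℚ.- a₁) ℚ.-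
             w₂ ℚ.* ((a₂ ℚ.+ (w₁ ℚ.* (y₂ ℚ.- b₂) ℚ.+ (ℚ.- w₂) ℚ.* (y₁ ℚ.- b₁))) ℚ.- a₂))) ℚ.- y₁ ≡
    (y₁ ℚ.- b₁) ℚ.* (w₁ ℚ.* w₁ ℚ.+ w₂ ℚ.* w₂ ℚ.- 1ℚ)
  eq₁ = solve-∀ ℚ-ring
  eq₂ : ∀ w₁ w₂ a₁ a₂ b₁ b₂ y₁ y₂ →
    (b₂ ℚ.+ (w₁ ℚ.* ((a₂ ℚ.+ (w₁ ℚ.* (y₂ ℚ.- b₂) ℚ.+ (ℚ.- w₂) ℚ.* (y₁ ℚ.- b₁))) ℚ.- a₂) ℚ.+
             w₂ ℚ.* ((a₁ ℚ.+ (w₁ ℚ.* (y₁ ℚ.- b₁) ℚ.- (ℚ.- w₂) ℚ.* (y₂ ℚ.- b₂))) ℚ.- a₁))) ℚ.- y₂ ≡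
    (y₂ ℚ.- b₂) ℚ.* (w₁ ℚ.* w₁ ℚ.+ w₂ ℚ.* w₂ ℚ.- 1ℚ)
  eq₂ = solve-∀ ℚ-ring

rotate-isIsometry : ∀ w a b → ∥ w ∥² ≈ const 1ℚ → IsIsometry (rotate w a b)
rotate-isIsometry w a b ∥w∥²≈1 = record
  { preserves-distance = λ p q d (0≤d , d²≈) → 0≤d ,
      ≈-trans {d * d} {∥ p ⊖ q ∥²} {∥ rotate w a b p ⊖ rotate w a b q ∥²} d²≈
        (≈-sym {∥ rotate w a b p ⊖ rotate w a b q ∥²} {∥ p ⊖ q ∥²}
          (rotate-preserves-∥∥² w a b p q ∥w∥²≈1))
  -- Surjectivity asks that every `z ≈₂ x` be sent to `y`, which is where `rotate-cong` enters.
  ; surjective = λ y → let x = rotate (conjugate w) b a y in x , λ {z} z≈x →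
      Setoid.trans ℝ²-setoid {rotate w a b z} {rotate w a b x} {y}
        (rotate-cong w a b z x z≈x) (rotate-conjugate w a b y ∥w∥²≈1)
  }

-- Circles are uncountable

-- (1 + it)² / (1 + t²) for k = 1 / (1 + t²), with (1 - t²) k written as 2 k - 1.
unit : (t k : ℝ) → ℝ²
unit t k = (k + k) - const 1ℚ , t * k + t * k

∥unit∥²≈1 : ∀ t k → (const 1ℚ + t * t) * k ≈ const 1ℚ → ∥ unit t k ∥² ≈ const 1ℚ
∥unit∥²≈1 t k [1+tt]k≈1 = null-resp (λ n → identity (seq t n) (seq k n))
  (((k + k) + (k + k)) *₀ [1+tt]k≈1)
  where
  identity : ∀ t k →
    ((k ℚ.+ k) ℚ.- 1ℚ) ℚ.* ((k ℚ.+ k) ℚ.- 1ℚ) ℚ.+ (t ℚ.* k ℚ.+ t ℚ.* k) ℚ.* (t ℚ.* k ℚ.+ t ℚ.* k) ℚ.- 1ℚ ≡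
    ((k ℚ.+ k) ℚ.+ (k ℚ.+ k)) ℚ.* ((1ℚ ℚ.+ t ℚ.* t) ℚ.* k ℚ.- 1ℚ)
  identity = solve-∀ ℚ-ring

-- The coordinates determine `k` and `t * k`. Hence `k ≈ l` and `t * k ≈ s * k`, and multiplying by
-- `1 + t * t` cancels `k`.
unit-injective : ∀ t k s l → (const 1ℚ + t * t) * k ≈ const 1ℚ → unit t k ≈₂ unit s l → t ≈ s
unit-injective t k s l [1+tt]k≈1 (k≈l , tk≈sl) = null-resp
  (λ n → identity (seq t n) (seq k n) (seq s n) (seq l n))
  ((s - t) *₀ [1+tt]k≈1 +₀
   (const ½ * (const 1ℚ + t * t)) *₀ tk≈sl +₀
   (- (const ½ * (s * (const 1ℚ + t * t)))) *₀ k≈l)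
  where
  identity : ∀ t k s l → t ℚ.- s ≡
    (s ℚ.- t) ℚ.* ((1ℚ ℚ.+ t ℚ.* t) ℚ.* k ℚ.- 1ℚ) ℚ.+
    ((½ ℚ.* (1ℚ ℚ.+ t ℚ.* t)) ℚ.* ((t ℚ.* k ℚ.+ t ℚ.* k) ℚ.- (s ℚ.* l ℚ.+ s ℚ.* l)) ℚ.+
     (ℚ.- (½ ℚ.* (s ℚ.* (1ℚ ℚ.+ t ℚ.* t)))) ℚ.* (((k ℚ.+ k) ℚ.- 1ℚ) ℚ.- ((l ℚ.+ l) ℚ.- 1ℚ)))
  identity = solve-∀ ℚ-ring

⊕⊙-onCircle : ∀ b w e → ∥ w ∥² ≈ const 1ℚ → Circle b ∥ e ∥² (b ⊕ w ⊙ e)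
⊕⊙-onCircle b@(b₁ , b₂) w e ∥w∥²≈1 =
  ≈-trans {∥ (b ⊕ w ⊙ e) ⊖ b ∥²} {∥ w ⊙ e ∥²} {∥ e ∥²}
    (∥∥²-cong-≗ ((b ⊕ w ⊙ e) ⊖ b) (w ⊙ e) λ n →
      eq (seq b₁ n) (seq (proj₁ (w ⊙ e)) n) , eq (seq b₂ n) (seq (proj₂ (w ⊙ e)) n))
    (∥w⊙u∥²≈∥u∥² w e ∥w∥²≈1)
  where
  eq : ∀ p q → (p ℚ.+ q) ℚ.- p ≡ q
  eq = solve-∀ ℚ-ring

-- Multiplying the conjugate of `e` by `i` gives the complex inverse of `e`; the coefficients are
-- its coordinates.
⊕⊙-injective : ∀ b w v e i → ∥ e ∥² * i ≈ const 1ℚ → b ⊕ w ⊙ e ≈₂ b ⊕ v ⊙ e → w ≈₂ v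
⊕⊙-injective (b₁ , b₂) (w₁ , w₂) (v₁ , v₂) (e₁ , e₂) i ei≈1 (h₁ , h₂) =
    null-resp (λ n → eq₁ (seq b₁ n) (seq b₂ n) (seq w₁ n) (seq w₂ n) (seq v₁ n) (seq v₂ n) (seq e₁ n) (seq e₂ n) (seq i n))
      ((i * e₁) *₀ h₁ +₀ (i * e₂) *₀ h₂ +₀ (v₁ - w₁) *₀ ei≈1)
  , null-resp (λ n → eq₂ (seq b₁ n) (seq b₂ n) (seq w₁ n) (seq w₂ n) (seq v₁ n) (seq v₂ n) (seq e₁ n) (seq e₂ n) (seq i n))
      ((i * e₁) *₀ h₂ +₀ (- (i * e₂)) *₀ h₁ +₀ (v₂ - w₂) *₀ ei≈1)
  where
  eq₁ : ∀ b₁ b₂ w₁ w₂ v₁ v₂ e₁ e₂ i → w₁ ℚ.- v₁ ≡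
    (i ℚ.* e₁) ℚ.* ((b₁ ℚ.+ (w₁ ℚ.* e₁ ℚ.- w₂ ℚ.* e₂)) ℚ.- (b₁ ℚ.+ (v₁ ℚ.* e₁ ℚ.- v₂ ℚ.* e₂))) ℚ.+
    ((i ℚ.* e₂) ℚ.* ((b₂ ℚ.+ (w₁ ℚ.* e₂ ℚ.+ w₂ ℚ.* e₁)) ℚ.- (b₂ ℚ.+ (v₁ ℚ.* e₂ ℚ.+ v₂ ℚ.* e₁))) ℚ.+
     (v₁ ℚ.- w₁) ℚ.* ((e₁ ℚ.* e₁ ℚ.+ e₂ ℚ.* e₂) ℚ.* i ℚ.- 1ℚ))
  eq₁ = solve-∀ ℚ-ring
  eq₂ : ∀ b₁ b₂ w₁ w₂ v₁ v₂ e₁ e₂ i → w₂ ℚ.- v₂ ≡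
    (i ℚ.* e₁) ℚ.* ((b₂ ℚ.+ (w₁ ℚ.* e₂ ℚ.+ w₂ ℚ.* e₁)) ℚ.- (b₂ ℚ.+ (v₁ ℚ.* e₂ ℚ.+ v₂ ℚ.* e₁))) ℚ.+
    ((ℚ.- (i ℚ.* e₂)) ℚ.* ((b₁ ℚ.+ (w₁ ℚ.* e₁ ℚ.- w₂ ℚ.* e₂)) ℚ.- (b₁ ℚ.+ (v₁ ℚ.* e₁ ℚ.- v₂ ℚ.* e₂))) ℚ.+
     (v₂ ℚ.- w₂) ℚ.* ((e₁ ℚ.* e₁ ℚ.+ e₂ ℚ.* e₂) ℚ.* i ℚ.- 1ℚ))
  eq₂ = solve-∀ ℚ-ring

-- Composed with `point`, an injection into ℕ would reflect equality to pointwise equality of bit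
-- sequences, against `cantor`.
Circle-uncountable : ExcludedMiddle 0ℓ → ∀ b e → ¬ ∥ e ∥² ≈ 0ℝ → Uncountable (Circle b ∥ e ∥²)
Circle-uncountable em b e e≉0 countable = cantor em (λ a → Injection.to countable (point a)) λ {a} {a′} eq n →
  expansionℝ-injective n
    (unit-injective (expansionℝ a) (k a) (expansionℝ a′) (k a′) (k-inverse a)
      (⊕⊙-injective b (unit (expansionℝ a) (k a)) (unit (expansionℝ a′) (k a′)) e
        (proj₁ e⁻¹) (proj₂ e⁻¹) (Injection.injective countable {point a} {point a′} eq)))
  where
  e⁻¹ = reciprocal em ∥ e ∥² e≉0

  k : (ℕ → Bool) → ℝ
  k a = proj₁ (reciprocal em (const 1ℚ + expansionℝ a * expansionℝ a) (1+t*t≉0 (expansionℝ a)))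

  k-inverse : ∀ a → (const 1ℚ + expansionℝ a * expansionℝ a) * k a ≈ const 1ℚ
  k-inverse a = proj₂ (reciprocal em (const 1ℚ + expansionℝ a * expansionℝ a) (1+t*t≉0 (expansionℝ a)))

  point : (ℕ → Bool) → Setoid.Carrier (subset (Circle b ∥ e ∥²))
  point a = b ⊕ unit (expansionℝ a) (k a) ⊙ e
    , ⊕⊙-onCircle b (unit (expansionℝ a) (k a)) e (∥unit∥²≈1 (expansionℝ a) (k a) (k-inverse a))

-- Rotations carrying a pair of points to another pair at the same distance

rotation-between : ∀ e f i → ∥ e ∥² * i ≈ const 1ℚ → ∥ f ∥² ≈ ∥ e ∥² →
  ∃[ w ] ∥ w ∥² ≈ const 1ℚ × w ⊙ e ≈₂ f
rotation-between e@(e₁ , e₂) f@(f₁ , f₂) i ei≈1 f≈e = w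
  , null-resp (λ n → norm (seq e₁ n) (seq e₂ n) (seq f₁ n) (seq f₂ n) (seq i n))
      ((∥ e ∥² * i * i) *₀ f≈e +₀ (∥ e ∥² * i + const 1ℚ) *₀ ei≈1)
  , null-resp (λ n → eq₁ (seq e₁ n) (seq e₂ n) (seq f₁ n) (seq f₂ n) (seq i n)) (f₁ *₀ ei≈1)
  , null-resp (λ n → eq₂ (seq e₁ n) (seq e₂ n) (seq f₁ n) (seq f₂ n) (seq i n)) (f₂ *₀ ei≈1)
  where
  -- The complex quotient of `f` by `e`: `f` times the conjugate of `e`, times `i`, the reciprocal
  -- of `∥ e ∥²`.
  w = i * (f₁ * e₁ + f₂ * e₂) , i * (f₂ * e₁ - f₁ * e₂)

  norm : ∀ e₁ e₂ f₁ f₂ i →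
    (i ℚ.* (f₁ ℚ.* e₁ ℚ.+ f₂ ℚ.* e₂)) ℚ.* (i ℚ.* (f₁ ℚ.* e₁ ℚ.+ f₂ ℚ.* e₂)) ℚ.+
    (i ℚ.* (f₂ ℚ.* e₁ ℚ.- f₁ ℚ.* e₂)) ℚ.* (i ℚ.* (f₂ ℚ.* e₁ ℚ.- f₁ ℚ.* e₂)) ℚ.- 1ℚ ≡
    ((e₁ ℚ.* e₁ ℚ.+ e₂ ℚ.* e₂) ℚ.* i ℚ.* i) ℚ.*
      ((f₁ ℚ.* f₁ ℚ.+ f₂ ℚ.* f₂) ℚ.- (e₁ ℚ.* e₁ ℚ.+ e₂ ℚ.* e₂)) ℚ.+
    ((e₁ ℚ.* e₁ ℚ.+ e₂ ℚ.* e₂) ℚ.* i ℚ.+ 1ℚ) ℚ.* ((e₁ ℚ.* e₁ ℚ.+ e₂ ℚ.* e₂) ℚ.* i ℚ.- 1ℚ)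
  norm = solve-∀ ℚ-ring
  eq₁ : ∀ e₁ e₂ f₁ f₂ i →
    (i ℚ.* (f₁ ℚ.* e₁ ℚ.+ f₂ ℚ.* e₂)) ℚ.* e₁ ℚ.- (i ℚ.* (f₂ ℚ.* e₁ ℚ.- f₁ ℚ.* e₂)) ℚ.* e₂ ℚ.- f₁ ≡
    f₁ ℚ.* ((e₁ ℚ.* e₁ ℚ.+ e₂ ℚ.* e₂) ℚ.* i ℚ.- 1ℚ)
  eq₁ = solve-∀ ℚ-ring
  eq₂ : ∀ e₁ e₂ f₁ f₂ i →
    (i ℚ.* (f₁ ℚ.* e₁ ℚ.+ f₂ ℚ.* e₂)) ℚ.* e₂ ℚ.+ (i ℚ.* (f₂ ℚ.* e₁ ℚ.- f₁ ℚ.* e₂)) ℚ.* e₁ ℚ.- f₂ ≡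
    f₂ ℚ.* ((e₁ ℚ.* e₁ ℚ.+ e₂ ℚ.* e₂) ℚ.* i ℚ.- 1ℚ)
  eq₂ = solve-∀ ℚ-ring

rotate-centre : ∀ w a b → rotate w a b a ≈₂ b
rotate-centre (w₁ , w₂) (a₁ , a₂) (b₁ , b₂) =
    pointwise {b₁ + (w₁ * (a₁ - a₁) - w₂ * (a₂ - a₂))} {b₁}
      (λ n → eq₁ (seq w₁ n) (seq w₂ n) (seq a₁ n) (seq a₂ n) (seq b₁ n))
  , pointwise {b₂ + (w₁ * (a₂ - a₂) + w₂ * (a₁ - a₁))} {b₂}
      (λ n → eq₂ (seq w₁ n) (seq w₂ n) (seq a₁ n) (seq a₂ n) (seq b₂ n))
  where
  eq₁ : ∀ w₁ w₂ a₁ a₂ b₁ → b₁ ℚ.+ (w₁ ℚ.* (a₁ ℚ.- a₁) ℚ.- w₂ ℚ.* (a₂ ℚ.- a₂)) ≡ b₁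
  eq₁ = solve-∀ ℚ-ring
  eq₂ : ∀ w₁ w₂ a₁ a₂ b₂ → b₂ ℚ.+ (w₁ ℚ.* (a₂ ℚ.- a₂) ℚ.+ w₂ ℚ.* (a₁ ℚ.- a₁)) ≡ b₂
  eq₂ = solve-∀ ℚ-ring

⊕-from-⊖ : ∀ b c u → u ≈₂ c ⊖ b → b ⊕ u ≈₂ c
⊕-from-⊖ (b₁ , b₂) (c₁ , c₂) (u₁ , u₂) (h₁ , h₂) =
    null-resp (λ n → eq (seq b₁ n) (seq c₁ n) (seq u₁ n)) h₁
  , null-resp (λ n → eq (seq b₂ n) (seq c₂ n) (seq u₂ n)) h₂
  where
  eq : ∀ b c u → b ℚ.+ u ℚ.- c ≡ u ℚ.- (c ℚ.- b)
  eq = solve-∀ ℚ-ring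

-- Compatibility with `≈₂` is recorded because the image of `C` also involves representatives that
-- are merely `≈₂` to `p` or `q`.
isometry-between : ExcludedMiddle 0ℓ → ∀ p q b c → ¬ p ≈₂ q → Circle b ∥ q ⊖ p ∥² c →
  ∃[ φ ] IsIsometry φ × (∀ x y → x ≈₂ y → φ x ≈₂ φ y) × φ p ≈₂ b × φ q ≈₂ c
isometry-between em p q b c p≉q c∈Circle = build (reciprocal em ∥ q ⊖ p ∥² (≉⇒∥q⊖p∥²≉0 p q p≉q))
  where
  build : ∃[ i ] ∥ q ⊖ p ∥² * i ≈ const 1ℚ → _
  build (i , ei≈1) =
    let w , ∥w∥²≈1 , we≈c⊖b = rotation-between (q ⊖ p) (c ⊖ b) i ei≈1 c∈Circle
    in rotate w p b , rotate-isIsometry w p b ∥w∥²≈1 , rotate-cong w p b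
      , rotate-centre w p b , ⊕-from-⊖ b c (w ⊙ (q ⊖ p)) we≈c⊖b

-- Bernstein sets and two-point sets

pair-in-Bernstein-set : ExcludedMiddle 0ℓ → (B : Pred ℝ² ℓ) → IsBernstein B → ∀ e → ¬ ∥ e ∥² ≈ 0ℝ →
  ∃[ b ] ∃[ c ] B b × B c × Circle b ∥ e ∥² c
pair-in-Bernstein-set em B bernstein e e≉0 =
  -- The first circle only supplies some point of `B`, so its centre is arbitrary; the second is
  -- centred at that point.
  let b , _ , b∈B = circle-meets-B e
      c , c∈Circle , c∈B = circle-meets-B b
  in b , c , b∈B , c∈B , c∈Circle
  where
  circle-meets-B : ∀ z → ∃[ x ] Circle z ∥ e ∥² x × B x
  circle-meets-B z = proj₁ (bernstein (Circle z ∥ e ∥²)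
    (Circle-Borel em z ∥ e ∥²) (Circle-uncountable em z e e≉0))

mainTheorem16 : ExcludedMiddle 0ℓ → {ℓ : Level} (B : Pred ℝ² ℓ) → IsSubset B → IsBernstein B → (2 -I-covering) B
mainTheorem16 em B B-resp bernstein C _ enumeration =
  let b , c , b∈B , c∈B , c∈Circle = pair-in-Bernstein-set em B bernstein (q ⊖ p) (≉⇒∥q⊖p∥²≉0 p q p≉q)
      φ , φ-isometry , φ-cong , φp≈b , φq≈c = isometry-between em p q b c p≉q c∈Circle
  in φ , φ-isometry , image⊆B φ b c b∈B c∈B φ-cong φp≈b φq≈c
  where
  open Bijection enumeration using (to; injective; surjective)
  module ≈₂ = Setoid ℝ²-setoid

  p = proj₁ (to Fin.zero)
  q = proj₁ (to (Fin.suc Fin.zero))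

  p≉q : ¬ p ≈₂ q
  p≉q p≈q = contradiction (injective {Fin.zero} {Fin.suc Fin.zero} p≈q) λ ()

  image⊆B : ∀ φ b c → B b → B c → (∀ x y → x ≈₂ y → φ x ≈₂ φ y) →
    φ p ≈₂ b → φ q ≈₂ c → image φ C ⊆ B
  image⊆B φ b c b∈B c∈B φ-cong φp≈b φq≈c {y} (x , x∈C , φx≈y) =
    let i , to≈x = surjective (x , x∈C) in cases i (to≈x refl)
    where
    B-via : ∀ z z′ → B z′ → φ z ≈₂ z′ → z ≈₂ x → B y
    B-via z z′ z′∈B φz≈z′ z≈x = B-resp {z′} {y}
      (≈₂.trans {z′} {φ z} {y} (≈₂.sym {φ z} {z′} φz≈z′)
        (≈₂.trans {φ z} {φ x} {y} (φ-cong z x z≈x) φx≈y)) z′∈B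

    -- By surjectivity of the enumeration, `x` is `≈₂` to one of the two listed points.
    cases : ∀ i → proj₁ (to i) ≈₂ x → B y
    cases Fin.zero           = B-via p b b∈B φp≈b
    cases (Fin.suc Fin.zero) = B-via q c c∈B φq≈c
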